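{- Let $G$ be an affine game with two distinct Left options $G^{L_1},G^{L_2}\in G^{\mathcal L}$ such that $G^{L_2}\geqslant G^{L_1}$. Then $G=\{G^{\mathcal L}\setminus\{G^{L_1}\}\mid G^{\mathcal R}\}$.
   Context: Affine games are defined recursively. There are two games without options, denoted $\infty$ and $\overline{\infty}$ (terminating games). Every other affine game is a form $G=\{G^{\mathcal L}\mid G^{\mathcal R}\}$, where $G^{\mathcal L}$ (Left options) and $G^{\mathcal R}$ (Right options) are non-empty finite sets of previously constructed affine games. Let $\mathbb A$ be the set of all affine games. Disjunctive sum: $G+H$ is undefined if one of $G,H$ is the form $\infty$ and the other is $\overline\infty$; it is $\infty$ if one is $\infty$ and the other is not $\overline\infty$; it is $\overline\infty$ if one is $\overline\infty$ and the other is not $\infty$; otherwise $G+H=\{G^{\mathcal L}+H,\,G+H^{\mathcal L}\mid G^{\mathcal R}+H,\,G+H^{\mathcal R}\}$. Outcomes: $o^L(G)=\mathbf L$ if $G=\infty$ or some $G^L\in G^{\mathcal L}$ has $o^R(G^L)=\mathbf L$, and $o^L(G)=\mathbf R$ otherwise; $o^R(G)=\mathbf R$ if $G=\overline\infty$ or some $G^R\in G^{\mathcal R}$ has $o^L(G^R)=\mathbf R$, and $o^R(G)=\mathbf L$ otherwise. With $\mathbf L>\mathbf R$, $o(G)=(o^L(G),o^R(G))$ is ordered componentwise. Order and equality: $G\geqslant H$ iff $o(G+X)\geqslant o(H+X)$ for all $X\in\mathbb A\setminus\{\infty,\overline\infty\}$; $G=H$ (equality of games) iff $o(G+X)=o(H+X)$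 for all such $X$. -}

module Defs where

open import Data.Empty using (⊥)
open import Data.Bool.Base using (if_then_else_)
open import Data.List.Base using (List; _∷_; filter; length)
open import Data.List.Properties using (filter-some)
open import Data.List.Relation.Unary.Any.Properties using (tabulate⁺)
open import Data.Nat.Base using (ℕ; suc; pred; _<_)
open import Data.Product.Base using (_×_; _,_)
open import Data.Product.Relation.Binary.Pointwise.NonDependent using (Pointwise)
open import Data.Unit.Base using (⊤; tt)
open import Data.Vec.Functional using (Vector; toList; fromList; _++_)
open import Data.Vec.Functional.Relation.Unary.All using (All)
open import Data.Vec.Functional.Relation.Unary.Any using (Any; any)
open import Relation.Binary.Definitions
  using (Reflexive; Symmetric; Transitive; Decidable; DecidableEquality)
open import Relation.Binary.PropositionalEquality using (_≡_; refl)
open import Relation.Nullary using (¬_; yes; no; does; ¬?; _×-dec_; map′)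

private
  variable
    m n m′ n′ : ℕ

infix  4 _≅_ _≅?_ _∈_ _≥ᵖ_ _≥ᵒ_ _≥_ _≈_
infixl 6 _∖_

-- A finite set of options is given by an enumeration, possibly with
-- repetitions; the enumeration is forgotten by the relation _≅_ below.
data Game : Set where
  ∞ ∞̄   : Game
  ⟨_∣_⟩ : Vector Game (suc m) → Vector Game (suc n) → Game

data NonTerminating : Game → Set where
  form : {L : Vector Game (suc m)} {R : Vector Game (suc n)} → NonTerminating ⟨ L ∣ R ⟩

-- Identity of forms: hereditarily, the same sets of options.
data _≅_ : Game → Game → Set where
  ∞≅∞   : ∞ ≅ ∞
  ∞̄≅∞̄   : ∞̄ ≅ ∞̄
  forms : {L : Vector Game (suc m)} {R : Vector Game (suc n)}
          {L′ : Vector Game (suc m′)} {R′ : Vector Game (suc n′)} →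
          All (λ x → Any (λ y → x ≅ y) L′) L → All (λ y → Any (λ x → x ≅ y) L) L′ →
          All (λ x → Any (λ y → x ≅ y) R′) R → All (λ y → Any (λ x → x ≅ y) R) R′ →
          ⟨ L ∣ R ⟩ ≅ ⟨ L′ ∣ R′ ⟩

≅-refl : Reflexive _≅_
≅-refl {∞}         = ∞≅∞
≅-refl {∞̄}         = ∞̄≅∞̄
≅-refl {⟨ L ∣ R ⟩} = forms (λ i → i , ≅-refl {L i}) (λ i → i , ≅-refl {L i})
                           (λ i → i , ≅-refl {R i}) (λ i → i , ≅-refl {R i})

≅-sym : Symmetric _≅_
≅-sym ∞≅∞   = ∞≅∞
≅-sym ∞̄≅∞̄   = ∞̄≅∞̄
≅-sym {⟨ L ∣ R ⟩} {⟨ L′ ∣ R′ ⟩} (forms f g h k) =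
  forms (λ j → let i , p = g j in i , ≅-sym {L i} {L′ j} p)
        (λ i → let j , p = f i in j , ≅-sym {L i} {L′ j} p)
        (λ j → let i , p = k j in i , ≅-sym {R i} {R′ j} p)
        (λ i → let j , p = h i in j , ≅-sym {R i} {R′ j} p)

≅-trans : Transitive _≅_
≅-trans ∞≅∞   q = q
≅-trans ∞̄≅∞̄   q = q
≅-trans {⟨ L ∣ R ⟩} {⟨ L′ ∣ R′ ⟩} {⟨ L″ ∣ R″ ⟩} (forms f g h k) (forms f′ g′ h′ k′) =
  forms
    (λ i → let j , p = f i ; l , q = f′ j in l , ≅-trans {L i} {L′ j} {L″ l} p q)
    (λ l → let j , q = g′ l ; i , p = g j in i , ≅-trans {L i} {L′ j} {L″ l} p q)
    (λ i → let j , p = h i ; l , q = h′ j in l , ≅-trans {R i} {R′ j} {R″ l} p q)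
    (λ l → let j , q = k′ l ; i , p = k j in i , ≅-trans {R i} {R′ j} {R″ l} p q)

_≅?_ : Decidable _≅_
∞           ≅? ∞           = yes ∞≅∞
∞           ≅? ∞̄           = no λ ()
∞           ≅? ⟨ _ ∣ _ ⟩   = no λ ()
∞̄           ≅? ∞           = no λ ()
∞̄           ≅? ∞̄           = yes ∞̄≅∞̄
∞̄           ≅? ⟨ _ ∣ _ ⟩   = no λ ()
⟨ _ ∣ _ ⟩   ≅? ∞           = no λ ()
⟨ _ ∣ _ ⟩   ≅? ∞̄           = no λ ()
⟨ L ∣ R ⟩   ≅? ⟨ L′ ∣ R′ ⟩ =
  map′ (λ (f , g , h , k) → forms f g h k) (λ { (forms f g h k) → f , g , h , k })
    (all? (λ i → any? λ j → L i ≅? L′ j) ×-dec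
     all? (λ j → any? λ i → L i ≅? L′ j) ×-dec
     all? (λ i → any? λ j → R i ≅? R′ j) ×-dec
     all? (λ j → any? λ i → R i ≅? R′ j))
  where open import Data.Fin.Properties using (all?; any?)

_∈_ : Game → Vector Game n → Set
x ∈ xs = Any (x ≅_) xs

_∖_ : Vector Game n → Game → List Game
xs ∖ x = filter (λ y → ¬? (x ≅? y)) (toList xs)

∖-nonEmpty : (xs : Vector Game n) {x y : Game} →
             y ∈ xs → ¬ x ≅ y → 0 < length (xs ∖ x)
∖-nonEmpty xs {x} (i , y≅xsᵢ) x≇y =
  filter-some (λ y → ¬? (x ≅? y))
    (tabulate⁺ i (λ x≅xsᵢ → x≇y (≅-trans x≅xsᵢ (≅-sym y≅xsᵢ))))

fromList⁺ : (xs : List Game) → .(0 < length xs) → Vector Game (suc (pred (length xs)))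
fromList⁺ xs@(_ ∷ _) _ = fromList xs

Summable : Game → Game → Set
Summable ∞ ∞̄ = ⊥
Summable ∞̄ ∞ = ⊥
Summable _ _ = ⊤

summableˡ : ∀ {G} H → NonTerminating G → Summable G H
summableˡ ∞         form = tt
summableˡ ∞̄         form = tt
summableˡ ⟨ _ ∣ _ ⟩ form = tt

summableʳ : ∀ G {H} → NonTerminating H → Summable G H
summableʳ ∞         form = tt
summableʳ ∞̄         form = tt
summableʳ ⟨ _ ∣ _ ⟩ form = tt

sum : (G H : Game) → .(Summable G H) → Game
sum ∞           ∞           _  = ∞
sum ∞           ∞̄           ()
sum ∞           ⟨ _ ∣ _ ⟩   _  = ∞
sum ∞̄           ∞           ()
sum ∞̄           ∞̄           _  = ∞̄
sum ∞̄           ⟨ _ ∣ _ ⟩   _  = ∞̄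
sum ⟨ _ ∣ _ ⟩   ∞           _  = ∞
sum ⟨ _ ∣ _ ⟩   ∞̄           _  = ∞̄
sum G@(⟨ L ∣ R ⟩) H@(⟨ L′ ∣ R′ ⟩) _ =
  ⟨ (λ i → sum (L i) H (summableʳ (L i) form)) ++ (λ j → sum G (L′ j) (summableˡ {G} (L′ j) form))
  ∣ (λ i → sum (R i) H (summableʳ (R i) form)) ++ (λ j → sum G (R′ j) (summableˡ {G} (R′ j) form)) ⟩

data Player : Set where
  𝐋 𝐑 : Player

_≟ᵖ_ : DecidableEquality Player
𝐋 ≟ᵖ 𝐋 = yes refl
𝐋 ≟ᵖ 𝐑 = no λ ()
𝐑 ≟ᵖ 𝐋 = no λ ()
𝐑 ≟ᵖ 𝐑 = yes refl

data _≥ᵖ_ : Player → Player → Set where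
  𝐋≥  : ∀ {p} → 𝐋 ≥ᵖ p
  𝐑≥𝐑 : 𝐑 ≥ᵖ 𝐑

Outcome : Set
Outcome = Player × Player

_≥ᵒ_ : Outcome → Outcome → Set
_≥ᵒ_ = Pointwise _≥ᵖ_ _≥ᵖ_

oᴸ oᴿ : Game → Player
oᴸ ∞         = 𝐋
oᴸ ∞̄         = 𝐑
oᴸ ⟨ L ∣ _ ⟩ = if does (any (_≟ᵖ 𝐋) (λ i → oᴿ (L i))) then 𝐋 else 𝐑
oᴿ ∞         = 𝐋
oᴿ ∞̄         = 𝐑
oᴿ ⟨ _ ∣ R ⟩ = if does (any (_≟ᵖ 𝐑) (λ i → oᴸ (R i))) then 𝐑 else 𝐋

o : Game → Outcome
o G = oᴸ G , oᴿ G

_≥_ : Game → Game → Set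
G ≥ H = ∀ X (nt : NonTerminating X) →
        o (sum G X (summableʳ G nt)) ≥ᵒ o (sum H X (summableʳ H nt))

-- Equality of games.
_≈_ : Game → Game → Set
G ≈ H = ∀ X (nt : NonTerminating X) →
        o (sum G X (summableʳ G nt)) ≡ o (sum H X (summableʳ H nt))

{-# OPTIONS --safe #-}

-- A Left option may be replaced by a larger one, and a Right option by a smaller one, without
-- making the game smaller: in G + X the options coming from G are compared by hypothesis, those
-- coming from X by induction. Deleting G₁ leaves G₂ ⩾ G₁ among the Left options, so each of the
-- two forms is at least the other, and the order on outcomes is antisymmetric.
module Submission where

open import Defs
open import Data.Bool.Base using (if_then_else_)
open import Data.Fin.Base using (_↑ˡ_; _↑ʳ_)
open import Data.List.Base using (List; _∷_; length)
open import Data.List.Membership.Propositional using () renaming (_∈_ to _∈ˡ_)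
open import Data.List.Membership.Propositional.Properties
  using (∈-filter⁺; ∈-filter⁻; ∈-tabulate⁺; ∈-tabulate⁻; ∈-lookup)
open import Data.List.Relation.Unary.Any using (index)
open import Data.List.Relation.Unary.Any.Properties using (lookup-index)
open import Data.Nat.Base using (ℕ; suc; _<_)
open import Data.Product.Base using (_,_; proj₁; proj₂)
open import Data.Vec.Functional using (Vector; _++_)
open import Data.Vec.Functional.Properties using (lookup-++ˡ; lookup-++ʳ)
open import Data.Vec.Functional.Relation.Unary.All using (All)
open import Data.Vec.Functional.Relation.Unary.All.Properties using (++⁺)
open import Data.Vec.Functional.Relation.Unary.Any using (Any; any)
open import Relation.Binary.Definitions using (Antisymmetric; Reflexive; Transitive)
open import Relation.Binary.PropositionalEquality using (_≡_; refl; sym; subst; cong₂)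
open import Relation.Nullary using (¬_; ¬?; Dec; does; yes; no; contradiction)

private
  variable
    m n m′ n′ : ℕ

≥ᵖ-refl : Reflexive _≥ᵖ_
≥ᵖ-refl {𝐋} = 𝐋≥
≥ᵖ-refl {𝐑} = 𝐑≥𝐑

≥ᵖ-trans : Transitive _≥ᵖ_
≥ᵖ-trans 𝐋≥  _ = 𝐋≥
≥ᵖ-trans 𝐑≥𝐑 p = p

≥ᵖ-antisym : Antisymmetric _≡_ _≥ᵖ_
≥ᵖ-antisym {𝐋} 𝐋≥  𝐋≥  = refl
≥ᵖ-antisym     𝐑≥𝐑 𝐑≥𝐑 = refl

≥ᵖ-𝐑 : ∀ {p} → p ≥ᵖ 𝐑
≥ᵖ-𝐑 {𝐋} = 𝐋≥
≥ᵖ-𝐑 {𝐑} = 𝐑≥𝐑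

≥-refl : ∀ G → G ≥ G
≥-refl _ X nt = ≥ᵖ-refl , ≥ᵖ-refl

≥-trans : ∀ G H K → G ≥ H → H ≥ K → G ≥ K
≥-trans _ _ _ p q X nt =
  ≥ᵖ-trans (proj₁ (p X nt)) (proj₁ (q X nt)) , ≥ᵖ-trans (proj₂ (p X nt)) (proj₂ (q X nt))

≥-antisym : ∀ G H → G ≥ H → H ≥ G → G ≈ H
≥-antisym _ _ p q X nt = cong₂ _,_ (≥ᵖ-antisym (proj₁ (p X nt)) (proj₁ (q X nt)))
                                   (≥ᵖ-antisym (proj₂ (p X nt)) (proj₂ (q X nt)))

if-mono : {A B : Set} (a? : Dec A) (b? : Dec B) → (A → B) →
          (if does b? then 𝐋 else 𝐑) ≥ᵖ (if does a? then 𝐋 else 𝐑)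
if-mono _       (yes _) _ = 𝐋≥
if-mono (no _)  (no _)  _ = 𝐑≥𝐑
if-mono (yes a) (no ¬b) f = contradiction (f a) ¬b

if-anti : {A B : Set} (a? : Dec A) (b? : Dec B) → (A → B) →
          (if does a? then 𝐑 else 𝐋) ≥ᵖ (if does b? then 𝐑 else 𝐋)
if-anti (no _)  _       _ = 𝐋≥
if-anti (yes _) (yes _) _ = 𝐑≥𝐑
if-anti (yes a) (no ¬b) f = contradiction (f a) ¬b

-- Left's winning option in `L` is matched by one in `L′` that still wins; Right's winning option in
-- `R′` is matched by one in `R`. Hence the two hypotheses run in opposite directions.
o-mono : (L : Vector Game (suc m)) (R : Vector Game (suc n))
         (L′ : Vector Game (suc m′)) (R′ : Vector Game (suc n′)) →
         All (λ x → Any (λ y → oᴿ y ≥ᵖ oᴿ x) L′) L →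
         All (λ y → Any (λ x → oᴸ y ≥ᵖ oᴸ x) R) R′ →
         o ⟨ L′ ∣ R′ ⟩ ≥ᵒ o ⟨ L ∣ R ⟩
o-mono L R L′ R′ f g =
  if-mono (any (_≟ᵖ 𝐋) (λ i → oᴿ (L i))) (any (_≟ᵖ 𝐋) (λ j → oᴿ (L′ j))) (λ (i , p) →
    -- `𝐋` is the greatest value, so anything above it equals it; in the Right case below, `𝐑` is
    -- the least.
    let j , q = f i in j , ≥ᵖ-antisym (subst (oᴿ (L′ j) ≥ᵖ_) p q) 𝐋≥) ,
  if-anti (any (_≟ᵖ 𝐑) (λ j → oᴸ (R′ j))) (any (_≟ᵖ 𝐑) (λ i → oᴸ (R i))) (λ (j , p) →
    let i , q = g j in i , ≥ᵖ-antisym ≥ᵖ-𝐑 (subst (_≥ᵖ oᴸ (R i)) p q))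

-- The relation is kept abstract so that one lemma serves Left options, matched from `G` to `G′`,
-- and Right options, matched from `G′` to `G`.
++-mono : (_~_ : Game → Game → Set)
          (xs : Vector Game m) (ys : Vector Game n) (xs′ : Vector Game m′) (ys′ : Vector Game n′) →
          All (λ x → Any (x ~_) xs′) xs → All (λ y → Any (y ~_) ys′) ys →
          All (λ x → Any (x ~_) (xs′ ++ ys′)) (xs ++ ys)
++-mono {m′ = m′} {n′} _~_ xs ys xs′ ys′ f g = ++⁺ (λ x → Any (x ~_) (xs′ ++ ys′)) {xs} {ys}
  (λ i → let j , p = f i in j ↑ˡ n′ , subst (xs i ~_) (sym (lookup-++ˡ xs′ ys′ j)) p)
  (λ i → let j , p = g i in m′ ↑ʳ j , subst (ys i ~_) (sym (lookup-++ʳ xs′ ys′ j)) p)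

-- With `sumsʳ`, names the two halves of the option vectors to which `sum` of two forms unfolds.
sumsˡ : Vector Game n → ∀ X → NonTerminating X → Vector Game n
sumsˡ V X nt i = sum (V i) X (summableʳ (V i) nt)

sumsʳ : ∀ G → NonTerminating G → Vector Game n → Vector Game n
sumsʳ G nt V i = sum G (V i) (summableˡ (V i) nt)

form-mono : (L : Vector Game (suc m)) (R : Vector Game (suc n))
            (L′ : Vector Game (suc m′)) (R′ : Vector Game (suc n′)) →
            All (λ x → Any (_≥ x) L′) L → All (λ y → Any (y ≥_) R) R′ →
            ⟨ L′ ∣ R′ ⟩ ≥ ⟨ L ∣ R ⟩
form-mono L R L′ R′ f g X _ = mono X
  where
  G = ⟨ L ∣ R ⟩
  G′ = ⟨ L′ ∣ R′ ⟩

  -- Options of a non-terminating `X` may be terminating, so the induction runs over every `X`; the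
  -- sums stay defined because `G` and `G′` are forms.
  mono : ∀ X → o (sum G′ X (summableˡ {G′} X form)) ≥ᵒ o (sum G X (summableˡ {G} X form))
  mono ∞ = ≥ᵖ-refl , ≥ᵖ-refl
  mono ∞̄ = ≥ᵖ-refl , ≥ᵖ-refl
  mono X@(⟨ Xᴸ ∣ Xᴿ ⟩) = o-mono
    (sumsˡ L X form ++ sumsʳ G form Xᴸ) (sumsˡ R X form ++ sumsʳ G form Xᴿ)
    (sumsˡ L′ X form ++ sumsʳ G′ form Xᴸ) (sumsˡ R′ X form ++ sumsʳ G′ form Xᴿ)
    (++-mono (λ x y → oᴿ y ≥ᵖ oᴿ x)
      (sumsˡ L X form) (sumsʳ G form Xᴸ) (sumsˡ L′ X form) (sumsʳ G′ form Xᴸ)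
      (λ i → let j , p = f i in j , proj₂ (p X form))
      (λ i → i , proj₂ (mono (Xᴸ i))))
    (++-mono (λ y x → oᴸ y ≥ᵖ oᴸ x)
      (sumsˡ R′ X form) (sumsʳ G′ form Xᴿ) (sumsˡ R X form) (sumsʳ G form Xᴿ)
      (λ j → let i , p = g j in i , proj₁ (p X form))
      (λ i → i , proj₁ (mono (Xᴿ i))))

-- Induction on forms: identical options are comparable, so `form-mono` applies. This links the
-- order to membership and deletion, which are taken up to `_≅_`.
≅⇒≥ : ∀ {G H} → G ≅ H → G ≥ H
≅⇒≥ ∞≅∞ = ≥-refl ∞
≅⇒≥ ∞̄≅∞̄ = ≥-refl ∞̄
≅⇒≥ {⟨ L ∣ R ⟩} {⟨ L′ ∣ R′ ⟩} (forms _ f g _) = form-mono L′ R′ L R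
  (λ j → let i , p = f j in i , ≅⇒≥ {L i} {L′ j} p)
  (λ i → let j , p = g i in j , ≅⇒≥ {R i} {R′ j} p)

lookup-fromList⁺ : (xs : List Game) (xs≢[] : 0 < length xs) → All (_∈ˡ xs) (fromList⁺ xs xs≢[])
lookup-fromList⁺ xs@(_ ∷ _) _ = ∈-lookup

fromList⁺-∈ : ∀ {G} (xs : List Game) (xs≢[] : 0 < length xs) →
              G ∈ˡ xs → Any (G ≡_) (fromList⁺ xs xs≢[])
fromList⁺-∈ xs@(_ ∷ _) _ G∈xs = index G∈xs , lookup-index G∈xs

theorem38 : {m n : ℕ} (L : Vector Game (suc m)) (R : Vector Game (suc n))
    (G₁ G₂ : Game) →
    G₁ ∈ L → (G₂∈L : G₂ ∈ L) (G₁≇G₂ : ¬ G₁ ≅ G₂) →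
    G₂ ≥ G₁ →
    ⟨ L ∣ R ⟩ ≈ ⟨ fromList⁺ (L ∖ G₁) (∖-nonEmpty L G₂∈L G₁≇G₂) ∣ R ⟩
theorem38 L R G₁ G₂ _ G₂∈L@(j , G₂≅Lⱼ) G₁≇G₂ G₂≥G₁ =
  ≥-antisym ⟨ L ∣ R ⟩ ⟨ kept ∣ R ⟩
    (form-mono kept R L R kept≤L R≤R) (form-mono L R kept R L≤kept R≤R)
  where
  ≇G₁? = λ y → ¬? (G₁ ≅? y)

  nonEmpty = ∖-nonEmpty L G₂∈L G₁≇G₂
  kept = fromList⁺ (L ∖ G₁) nonEmpty

  R≤R : All (λ y → Any (y ≥_) R) R
  R≤R i = i , ≥-refl (R i)

  kept≤L : All (λ x → Any (_≥ x) L) kept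
  kept≤L k =
    let i , keptₖ≡Lᵢ = ∈-tabulate⁻ {f = L} (proj₁ (∈-filter⁻ ≇G₁? (lookup-fromList⁺ (L ∖ G₁) nonEmpty k)))
    in i , subst (L i ≥_) (sym keptₖ≡Lᵢ) (≥-refl (L i))

  keep : ∀ i → ¬ G₁ ≅ L i → Any (_≥ L i) kept
  keep i G₁≇Lᵢ =
    let k , Lᵢ≡keptₖ = fromList⁺-∈ (L ∖ G₁) nonEmpty (∈-filter⁺ ≇G₁? (∈-tabulate⁺ {f = L} i) G₁≇Lᵢ)
    in k , subst (_≥ L i) Lᵢ≡keptₖ (≥-refl (L i))

  L≤kept : All (λ x → Any (_≥ x) kept) L
  L≤kept i with G₁ ≅? L i
  ... | no G₁≇Lᵢ = keep i G₁≇Lᵢ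
  -- This entry was deleted. Its substitute is `L j`, the copy of `G₂`, which survives since
  -- otherwise `G₁ ≅ G₂`; the chain is `kept k` ≥ `L j` ≥ `G₂` ≥ `G₁` ≥ `L i`.
  ... | yes G₁≅Lᵢ =
    let k , keptₖ≥Lⱼ = keep j (λ G₁≅Lⱼ → G₁≇G₂ (≅-trans G₁≅Lⱼ (≅-sym G₂≅Lⱼ)))
    in k , ≥-trans (kept k) (L j) (L i) keptₖ≥Lⱼ
             (≥-trans (L j) G₂ (L i) (≅⇒≥ (≅-sym G₂≅Lⱼ))
               (≥-trans G₂ G₁ (L i) G₂≥G₁ (≅⇒≥ G₁≅Lᵢ)))
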